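{- Let $\langle E_1,\ldots,E_n,op_1,\ldots,op_p\rangle$ be a structure with stable computability. Then, for all families of sets $F_1,\ldots,F_{m+1}$ and all indexings $i_1,\ldots,i_{m+1}$ and $i'_1,\ldots,i'_{m+1}$ of this family such that for all $k$ either $i_k=i'_k$, or $F_k$ is some $E_l$ and $i_k$ and $i'_k$ are two indexings of $E_l$ extracted from two admissible indexings of the structure $\langle E_1,\ldots,E_n,op_1,\ldots,op_p\rangle$ (that is, $i_k$ and $i'_k$ are the $l$-th components of two such admissible indexings), the set of functions from $F_1\times\ldots\times F_m$ to $F_{m+1}$ that are computable relatively to $i_1,\ldots,i_{m+1}$ is the same as the set of those computable relatively to $i'_1,\ldots,i'_{m+1}$.
   Context: Computability over natural numbers is the usual one. A set $A \subseteq \mathbb{N}$ is effectively enumerable if it is empty or the image of a total computable function from $\mathbb{N}$ to $\mathbb{N}$. For $A \subseteq \mathbb{N}^m$ and $B \subseteq \mathbb{N}$, a computable function from $A$ to $B$ is a partial computable function that is defined at every element of $A$ and takes values in $B$ there. Indexing: an indexing of a set $E$ is a partial function $i$ from $\mathbb{N}$ to $E$ such that $dom(i)$ is effectively enumerable, $i$ is surjective, and there is a computable function $eq$ from $dom(i)\times dom(i)$ to $\{0,1\}$ with $eq(x,y)=1$ if $i(x)=i(y)$ and $eq(x,y)=0$ otherwise. An indexing of a family of sets $E_1,\ldots,E_n$ is a family $i_1,\ldots,i_n$ of indexings of $E_1,\ldots,E_n$. Computable function: given sets $E_1,\ldots,E_m,E_{m+1}$ with indexings $i_1,\ldots,i_{m+1}$,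 a function $f: E_1\times\ldots\times E_m \to E_{m+1}$ is computable relatively to this indexing if there is a computable function $\hat f$ from $dom(i_1)\times\ldots\times dom(i_m)$ to $dom(i_{m+1})$ such that $i_{m+1}(\hat f(x_1,\ldots,x_m)) = f(i_1(x_1),\ldots,i_m(x_m))$ for all $x_k \in dom(i_k)$. Admissible indexing: a structure $\langle E_1,\ldots,E_n,op_1,\ldots,op_p\rangle$ consists of sets $E_1,\ldots,E_n$ and operations, each from a product of some of these sets to one of these sets. An indexing of it is an indexing of $E_1,\ldots,E_n$; it is admissible if every $op_k$ is computable relatively to the indexings of its domains and co-domain. Stable computability: computability is stable over $\langle E_1,\ldots,E_n,op_1,\ldots,op_p\rangle$ if there exists an admissible indexing of this structure and, for all admissible indexings $j_1,\ldots,j_n$ and $j'_1,\ldots,j'_n$ of it, there exist computable functions $h_k$ from $dom(j'_k)$ to $dom(j_k)$ such that $j'_k = j_k\circ h_k$, for $k=1,\ldots,n$. -}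

module Defs where

open import Level using (Level; _⊔_) renaming (suc to lsuc)
open import Data.Nat.Base using (ℕ; zero; suc; _<_)
open import Data.Fin.Base using (Fin; zero; suc; inject₁; fromℕ)
open import Data.Vec.Base using (Vec; []; _∷_; lookup)
open import Data.Vec.Relation.Unary.All using (All)
open import Data.Vec.Relation.Binary.Pointwise.Inductive using (Pointwise)
open import Data.Product.Base using (Σ; ∃; _×_; _,_; proj₁; proj₂)
open import Data.Sum.Base using (_⊎_)
open import Data.Unit.Polymorphic.Base using (⊤)
open import Function.Bundles using (_⇔_)
open import Relation.Binary.PropositionalEquality using (_≡_; _≢_; subst)
open import Relation.Nullary.Negation using (¬_)
open import Relation.Unary using (Pred; U)

private
  variable
    a b ℓ : Level
    m n : ℕ

-- Partial recursive (μ-recursive) functions ℕᵐ ⇀ ℕ.  In `prim`, the step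
-- function receives the recursion counter, then the previous value.

data Code : ℕ → Set where
  zer  : Code n
  succ : Code 1
  proj : Fin n → Code n
  comp : Code m → Vec (Code n) m → Code n
  prim : Code n → Code (suc (suc n)) → Code (suc n)
  mu   : Code (suc n) → Code n

infix 4 _[_]⇓_

-- c [ xs ]⇓ y : the function c is defined at xs, with value y.

data _[_]⇓_ : Code n → Vec ℕ n → ℕ → Set where
  ⇓zer   : {xs : Vec ℕ n} → zer [ xs ]⇓ 0
  ⇓succ  : ∀ {x} → succ [ x ∷ [] ]⇓ suc x
  ⇓proj  : ∀ {xs : Vec ℕ n} k → proj k [ xs ]⇓ lookup xs k
  ⇓comp  : ∀ {f : Code m} {gs : Vec (Code n) m} {xs ys z} →
           Pointwise (λ g y → g [ xs ]⇓ y) gs ys →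
           f [ ys ]⇓ z →
           comp f gs [ xs ]⇓ z
  ⇓prim0 : ∀ {f : Code n} {g xs y} →
           f [ xs ]⇓ y →
           prim f g [ 0 ∷ xs ]⇓ y
  ⇓prim+ : ∀ {f : Code n} {g xs k y z} →
           prim f g [ k ∷ xs ]⇓ y →
           g [ k ∷ y ∷ xs ]⇓ z →
           prim f g [ suc k ∷ xs ]⇓ z
  ⇓mu    : ∀ {f : Code (suc n)} {xs y} →
           f [ y ∷ xs ]⇓ 0 →
           (∀ z → z < y → ∃ λ v → f [ z ∷ xs ]⇓ suc v) →
           mu f [ xs ]⇓ y

-- Computable functions from A ⊆ ℕᵐ to B ⊆ ℕ; nothing is required of the
-- underlying partial function outside A.

record ComputableFunction (A : Pred (Vec ℕ m) a) (B : Pred ℕ b) : Set (a ⊔ b) where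
  field
    code : Code m
    maps : ∀ xs → A xs → ∃ λ y → code [ xs ]⇓ y × B y

open ComputableFunction public

TotalComputable : Set
TotalComputable = ComputableFunction {m = 1} U U

EffectivelyEnumerable : Pred ℕ a → Set a
EffectivelyEnumerable A =
  (∀ x → ¬ A x) ⊎
  Σ TotalComputable λ g → ∀ x → A x ⇔ (∃ λ k → code g [ k ∷ [] ]⇓ x)

-- A partial function i from ℕ to E is given by its graph: `Graph x e` says
-- that i is defined at x and i(x) = e.

record Indexing (E : Set ℓ) : Set (lsuc ℓ) where
  field
    Graph      : ℕ → E → Set ℓ
    functional : ∀ {x e e′} → Graph x e → Graph x e′ → e ≡ e′

  Dom : Pred ℕ ℓ
  Dom x = ∃ λ e → Graph x e

  field
    dom-enumerable : EffectivelyEnumerable Dom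
    surjective     : ∀ e → ∃ λ x → Graph x e
    eq             : ComputableFunction {m = 2} (All Dom) (λ y → y ≡ 0 ⊎ y ≡ 1)
    eq-equal       : ∀ {x y e e′} → Graph x e → Graph y e′ →
                     e ≡ e′ → code eq [ x ∷ y ∷ [] ]⇓ 1
    eq-distinct    : ∀ {x y e e′} → Graph x e → Graph y e′ →
                     e ≢ e′ → code eq [ x ∷ y ∷ [] ]⇓ 0

open Indexing public using (Graph; Dom)

-- Equality of indexings is equality of the underlying partial functions; the
-- witnesses for enumerability, surjectivity and eq are not compared.

infix 4 _≈_

_≈_ : {E : Set ℓ} → Indexing E → Indexing E → Set ℓ
i ≈ j = ∀ x e → Graph i x e ⇔ Graph j x e

Indexings : (Fin n → Set ℓ) → Set (lsuc ℓ)
Indexings E = ∀ k → Indexing (E k)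

Tuple : (Fin m → Set ℓ) → Set ℓ
Tuple {zero} F = ⊤
Tuple {suc m} F = F zero × Tuple (λ k → F (suc k))

component : {F : Fin m → Set ℓ} → Tuple F → ∀ k → F k
component t zero    = proj₁ t
component t (suc k) = component (proj₂ t) k

Doms : {F : Fin m → Set ℓ} → Indexings F → Pred (Vec ℕ m) ℓ
Doms i xs = ∀ k → Dom (i k) (lookup xs k)

ComputableRelativeTo : {F : Fin m → Set ℓ} {G : Set ℓ} →
                       Indexings F → Indexing G → (Tuple F → G) → Set ℓ
ComputableRelativeTo {F = F} i j f =
  Σ (ComputableFunction (Doms i) (Dom j)) λ f̂ →
    ∀ xs (es : Tuple F) → (∀ k → Graph (i k) (lookup xs k) (component es k)) →
    ∀ y → code f̂ [ xs ]⇓ y → Graph j y (f es)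

record Structure ℓ : Set (lsuc ℓ) where
  field
    {#sets #ops} : ℕ
    E            : Fin #sets → Set ℓ
    arity        : Fin #ops → ℕ
    source       : ∀ q → Fin (arity q) → Fin #sets
    target       : Fin #ops → Fin #sets
    op           : ∀ q → Tuple (λ k → E (source q k)) → E (target q)

open Structure public using (#sets; #ops; E)

Admissible : (S : Structure ℓ) → Indexings (E S) → Set ℓ
Admissible S j = ∀ q → ComputableRelativeTo (λ k → j (source q k)) (j (target q)) (op q)
  where open Structure S

-- j′ = j ∘ h for some computable h : dom(j′) → dom(j).

Translation : {E : Set ℓ} → Indexing E → Indexing E → Set ℓ
Translation j′ j =
  Σ (ComputableFunction (All (Dom j′)) (Dom j)) λ h →
    ∀ x → Dom j′ x → ∀ y → code h [ x ∷ [] ]⇓ y →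
    ∀ e → Graph j′ x e ⇔ Graph j y e

StableComputability : Structure ℓ → Set (lsuc ℓ)
StableComputability S =
  Σ (Indexings (E S)) (Admissible S) ×
  (∀ (j j′ : Indexings (E S)) → Admissible S j → Admissible S j′ →
   ∀ k → Translation (j′ k) (j k))

-- i and i′ are the l-th components of two admissible indexings of S, where F
-- is the l-th set of S.

Extracted : (S : Structure ℓ) {F : Set ℓ} → Indexing F → Indexing F → Set (lsuc ℓ)
Extracted S {F} i i′ =
  ∃ λ l → Σ (F ≡ E S l) λ F≡E →
  Σ (Indexings (E S)) λ j → Σ (Indexings (E S)) λ j′ →
    Admissible S j × Admissible S j′ ×
    subst Indexing F≡E i ≈ j l × subst Indexing F≡E i′ ≈ j′ l

-- Computability of f : F₁ × … × Fₘ → Fₘ₊₁ relatively to i₁, …, iₘ₊₁.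

Computable : {F : Fin (suc m) → Set ℓ} → Indexings F →
             (Tuple (λ k → F (inject₁ k)) → F (fromℕ m)) → Set ℓ
Computable {m = m} i = ComputableRelativeTo (λ k → i (inject₁ k)) (i (fromℕ m))

{-# OPTIONS --safe #-}
module Submission where

-- Stability makes i and i′ mutually translatable, so conjugating a code for f
-- by the translations of its arguments (from i′ to i) and of its result (from
-- i to i′) turns computability relatively to i into computability relatively
-- to i′.

open import Level using (Level)
open import Data.Nat.Base using (ℕ; suc)
open import Data.Fin.Base using (Fin; zero; inject₁; fromℕ)
open import Data.Product.Base using (∃; _×_; _,_; proj₁; proj₂; map₂)
open import Data.Sum.Base using (_⊎_; [_,_]) renaming (map to map-⊎)
open import Data.Vec.Base using (Vec; []; _∷_; lookup; tabulate)
open import Data.Vec.Properties using (lookup∘tabulate)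
open import Data.Vec.Relation.Unary.All as All using ([]; _∷_)
open import Data.Vec.Relation.Binary.Pointwise.Inductive as Pointwise using ([]; _∷_)
open import Function.Base using (_∘_)
open import Function.Bundles using (_⇔_; mk⇔; module Equivalence)
open import Function.Construct.Composition using (_⇔-∘_)
open import Function.Construct.Symmetry using (⇔-sym)
open import Relation.Binary.PropositionalEquality using (refl; sym; subst)
open import Defs

open Equivalence using (to)

private
  variable
    ℓ : Level
    m n : ℕ
    A : Set ℓ

≈-sym : (i j : Indexing A) → i ≈ j → j ≈ i
≈-sym i j i≈j x e = ⇔-sym (i≈j x e)

Dom-resp-≈ : (i j : Indexing A) → i ≈ j → ∀ {x} → Dom i x → Dom j x
Dom-resp-≈ i j i≈j (e , g) = e , to (i≈j _ e) g

Extracted-sym : (S : Structure ℓ) (i i′ : Indexing A) → Extracted S i i′ → Extracted S i′ i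
Extracted-sym S i i′ (l , F≡E , j , j′ , adm , adm′ , i≈j , i′≈j′) =
  l , F≡E , j′ , j , adm′ , adm , i′≈j′ , i≈j

-- The identity function, coded as the only unary projection, is the translation.
≈⇒Translation : (i j : Indexing A) → i ≈ j → Translation i j
≈⇒Translation i j i≈j =
  record
    { code = proj zero
    ; maps = λ { (x ∷ []) (d ∷ []) → x , ⇓proj zero , Dom-resp-≈ i j i≈j d } }
  , λ { x _ .x (⇓proj zero) e → i≈j x e }

Translation-resp-≈ : (i i′ j j′ : Indexing A) → i′ ≈ i → j ≈ j′ →
                     Translation i j → Translation i′ j′
Translation-resp-≈ i i′ j j′ i′≈i j≈j′ (h , h-graph) =
  record
    { code = code h
    ; maps = λ xs ds → map₂ (map₂ (Dom-resp-≈ j j′ j≈j′))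
                            (maps h xs (All.map (Dom-resp-≈ i′ i i′≈i) ds)) }
  , λ x d y h⇓y e →
      j≈j′ y e ⇔-∘ (h-graph x (Dom-resp-≈ i′ i i′≈i d) y h⇓y e ⇔-∘ i′≈i x e)

Extracted⇒Translation : (S : Structure ℓ) → StableComputability S →
                        (i i′ : Indexing A) → Extracted S i i′ → Translation i i′
Extracted⇒Translation S (_ , stable) i i′ (l , refl , j , j′ , adm , adm′ , i≈j , i′≈j′) =
  -- `stable` translates its second family into its first, hence the swapped order of `j` and `j′`.
  Translation-resp-≈ (j l) i (j′ l) i′ i≈j (≈-sym i′ (j′ l) i′≈j′) (stable j′ j adm′ adm l)

-- The product map `h₁ × … × hₙ`. Since `comp` feeds the whole input vector to every inner code,
-- each `h k` is first composed with the projection to its own coordinate.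
onEach : (Fin n → Code 1) → Vec (Code n) n
onEach h = tabulate λ k → comp (h k) (proj k ∷ [])

onEach-⇓ : (h : Fin n → Code 1) {xs : Vec ℕ n} {y : Fin n → ℕ} →
           (∀ k → h k [ lookup xs k ∷ [] ]⇓ y k) →
           Pointwise.Pointwise (_[ xs ]⇓_) (onEach h) (tabulate y)
onEach-⇓ h h⇓y = Pointwise.tabulate⁺ λ k → ⇓comp (⇓proj k ∷ []) (h⇓y k)

-- The graph clauses speak of every output of a code, so correctness of a composite requires reading
-- the intermediate values `ys` off an arbitrary derivation.
onEach-⇓⁻¹ : (h : Fin n → Code 1) {xs ys : Vec ℕ n} →
             Pointwise.Pointwise (_[ xs ]⇓_) (onEach h) ys →
             ∀ k → h k [ lookup xs k ∷ [] ]⇓ lookup ys k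
onEach-⇓⁻¹ h {xs} {ys} hs⇓ys k
  -- `lookup` of a `tabulate` at a variable index does not reduce; only after this rewriting is the
  -- code visibly a `comp`, so that the derivation can be inverted.
  with ⇓comp (⇓proj .k ∷ []) h⇓y ← subst (_[ xs ]⇓ lookup ys k)
         (lookup∘tabulate (λ k → comp (h k) (proj k ∷ [])) k) (Pointwise.lookup hs⇓ys k)
  = h⇓y

ComputableRelativeTo-translate :
  {F : Fin m → Set ℓ} {G : Set ℓ} (i i′ : Indexings F) (j j′ : Indexing G) →
  (∀ k → Translation (i′ k) (i k)) → Translation j j′ →
  {f : Tuple F → G} → ComputableRelativeTo i j f → ComputableRelativeTo i′ j′ f
ComputableRelativeTo-translate {m = m} i i′ j j′ t (u , u-graph) {f} (f̂ , f̂-graph) =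
  record { code = ĝ ; maps = ĝ-maps } , ĝ-graph
  where
  h : Fin m → Code 1
  h k = code (proj₁ (t k))

  ĝ : Code m
  ĝ = comp (code u) (comp (code f̂) (onEach h) ∷ [])

  ĝ-maps : ∀ xs → Doms i′ xs → ∃ λ z → ĝ [ xs ]⇓ z × Dom j′ z
  ĝ-maps xs ds =
    let h-maps k           = maps (proj₁ (t k)) (lookup xs k ∷ []) (ds k ∷ [])
        ys                 = tabulate (proj₁ ∘ h-maps)
        ys-Doms k          = subst (Dom (i k)) (sym (lookup∘tabulate (proj₁ ∘ h-maps) k))
                                   (proj₂ (proj₂ (h-maps k)))
        y , f̂⇓y , y-Dom   = maps f̂ ys ys-Doms
        z , u⇓z , z-Dom    = maps u (y ∷ []) (y-Dom ∷ [])
    in z , ⇓comp (⇓comp (onEach-⇓ h (proj₁ ∘ proj₂ ∘ h-maps)) f̂⇓y ∷ []) u⇓z , z-Dom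

  ĝ-graph : ∀ xs es → (∀ k → Graph (i′ k) (lookup xs k) (component es k)) →
            ∀ z → ĝ [ xs ]⇓ z → Graph j′ z (f es)
  ĝ-graph xs es gs z (⇓comp (⇓comp {ys = ys} hs⇓ys f̂⇓y ∷ []) u⇓z) =
    -- Each `h k` turns an index of `component es k` under `i′ k` into one under `i k`. Hence `f̂`
    -- yields an index of `f es` under `j`, and `u` keeps the element it denotes.
    to (u-graph _ (_ , y-graph) z u⇓z (f es)) y-graph
    where
    y-graph = f̂-graph ys es
      (λ k → to (proj₂ (t k) _ (_ , gs k) _ (onEach-⇓⁻¹ h hs⇓ys k) _) (gs k)) _ f̂⇓y

proposition2 : ∀ {ℓ} (S : Structure ℓ) → StableComputability S →
    ∀ (m : ℕ) (F : Fin (suc m) → Set ℓ) (i i′ : Indexings F) →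
    (∀ k → (i k ≈ i′ k) ⊎ Extracted S (i k) (i′ k)) →
    ∀ (f : Tuple (λ k → F (inject₁ k)) → F (fromℕ m)) →
    Computable i f ⇔ Computable i′ f
proposition2 S stable m F i i′ related f =
  mk⇔ (transfer i i′ forward backward) (transfer i′ i backward forward)
  where
  translation : (i i′ : Indexings F) → (∀ k → (i k ≈ i′ k) ⊎ Extracted S (i k) (i′ k)) →
                ∀ k → Translation (i k) (i′ k)
  translation i i′ rel k =
    [ ≈⇒Translation (i k) (i′ k) , Extracted⇒Translation S stable (i k) (i′ k) ] (rel k)

  forward : ∀ k → Translation (i k) (i′ k)
  forward = translation i i′ related

  -- The hypothesis is symmetric in `i` and `i′`, because stability compares admissible indexings in
  -- both orders.
  backward : ∀ k → Translation (i′ k) (i k)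
  backward = translation i′ i λ k →
    map-⊎ (≈-sym (i k) (i′ k)) (Extracted-sym S (i k) (i′ k)) (related k)

  transfer : (i i′ : Indexings F) → (∀ k → Translation (i k) (i′ k)) →
             (∀ k → Translation (i′ k) (i k)) → Computable i f → Computable i′ f
  -- The first `m` indexings belong to arguments and are translated back by `t′`; the last belongs
  -- to the result and is translated by `t`.
  transfer i i′ t t′ = ComputableRelativeTo-translate
    (i ∘ inject₁) (i′ ∘ inject₁) (i (fromℕ m)) (i′ (fromℕ m)) (t′ ∘ inject₁) (t (fromℕ m))
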